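{- Let $d$, $\Delta$, and $s$ be integers with $1\le d\le\Delta$ and $0\le s<\Delta$. Let $G$ be a finite simple $d$-degenerate graph with maximum degree $\Delta(G)\le\Delta$. If $q_B(G)\ge d\Delta-s$, then $G$ contains a copy of $K_{d,\Delta-s}$. If in addition $s<d$, then $G$ also contains a copy of $K_{d-s,\Delta}$.
   Context: A $B$-coloring of a graph $G$ is a proper edge-coloring (incident edges receive distinct colors) in which the edges of every $4$-cycle receive four distinct colors; $q_B(G)$ is the minimum number of colors in a $B$-coloring of $G$. A graph is $d$-degenerate if every nonempty subgraph has a vertex of degree at most $d$ (in that subgraph). "Contains a copy of $K_{a,b}$" means contains a subgraph, not necessarily induced, isomorphic to the complete bipartite graph $K_{a,b}$. $\Delta(G)$ denotes the maximum degree of $G$. -}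

module Defs where

open import Data.Empty using (⊥; ⊥-elim)
open import Data.Fin.Base using (Fin; zero; combine; remQuot; finToFun; funToFin)
open import Data.Fin.Properties
  using (_≟_; _≤?_; ≤-antisym; ≤-total; any?; all?; combine-injective;
         remQuot-combine; finToFun-funToFin)
open import Data.Fin.Subset using (Subset; Nonempty; _∈_)
open import Data.List.Base using ([]; _∷_; length; filter; map; allFin)
open import Data.List.Extrema.Nat using (max)
open import Data.List.Relation.Unary.All using ([]; _∷_)
open import Data.List.Relation.Unary.AllPairs using ([]; _∷_)
open import Data.List.Relation.Unary.Unique.Propositional using (Unique)
import Data.List.Relation.Unary.Unique.DecPropositional as DecUnique
open import Data.Nat.Base as ℕ using (ℕ; zero; suc; _≤_; z≤n; s≤s)
open import Data.Product.Base using (∃; ∃-syntax; Σ-syntax; _×_; _,_; proj₁; proj₂; uncurry)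
open import Data.Sum.Base using (_⊎_; inj₁; inj₂)
open import Data.Unit.Base using (⊤; tt)
open import Function.Base using (_∘_)
open import Function.Bundles using (_⇔_)
open import Function.Definitions using (Injective)
open import Level using (0ℓ)
open import Relation.Binary.Core using (Rel)
open import Relation.Binary.Definitions using (Symmetric; Irreflexive; Decidable)
open import Relation.Binary.PropositionalEquality
  using (_≡_; _≢_; refl; sym; trans; cong)
open import Relation.Nullary.Decidable.Core
  using (Dec; yes; no; map′; ¬?; _×-dec_; _→-dec_)
open import Relation.Nullary.Negation.Core using (¬_; contradiction)
import Relation.Unary as U

-- A simple graph on V.  A finite graph is a Graph (Fin n); decidability
-- of adjacency is what "finite graph" provides classically.
record Graph (V : Set) : Set₁ where
  infix 4 _~_ _~?_
  field
    _~_      : Rel V 0ℓ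
    _~?_     : Decidable _~_
    ~-sym    : Symmetric _~_
    ~-irrefl : Irreflexive _≡_ _~_

degree : ∀ {n} → Graph (Fin n) → Fin n → ℕ
degree {n} G v = length (filter (v ~?_) (allFin n))
  where open Graph G

-- The value on the graph without vertices is 0.
maxDegree : ∀ {n} → Graph (Fin n) → ℕ
maxDegree {n} G = max 0 (map (degree G) (allFin n))

-- A not necessarily induced subgraph: the vertices outside `vertices`
-- are kept in the carrier of `edges`, but no edge may touch them.
record Subgraph {n} (G : Graph (Fin n)) : Set₁ where
  field
    vertices : Subset n
    edges    : Graph (Fin n)
  open Graph edges public
  field
    ~⇒∈ : ∀ {u v} → u ~ v → u ∈ vertices × v ∈ vertices
    ~⇒~ : ∀ {u v} → u ~ v → Graph._~_ G u v

Degenerate : ∀ {n} → ℕ → Graph (Fin n) → Set₁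
Degenerate d G =
  (H : Subgraph G) → let open Subgraph H in
  Nonempty vertices → ∃[ v ] v ∈ vertices × degree edges v ≤ d

infix 4 _≅_
record _≅_ {V : Set} {n} {G : Graph (Fin n)} (K : Graph V) (H : Subgraph G) : Set where
  private
    module K = Graph K
    module H = Subgraph H
  field
    to         : V → Fin n
    injective  : Injective _≡_ _≡_ to
    to-∈       : ∀ x → to x ∈ H.vertices
    surjective : ∀ {v} → v ∈ H.vertices → ∃[ x ] to x ≡ v
    adjacency  : ∀ {x y} → (x K.~ y) ⇔ (to x H.~ to y)

ContainsCopy : ∀ {V : Set} {n} → Graph (Fin n) → Graph V → Set₁
ContainsCopy G K = Σ[ H ∈ Subgraph G ] K ≅ H

K[_,_] : (a b : ℕ) → Graph (Fin a ⊎ Fin b)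
K[ a , b ] = record
  { _~_      = _~_
  ; _~?_     = λ { (inj₁ _) (inj₁ _) → no λ ()
                 ; (inj₁ _) (inj₂ _) → yes tt
                 ; (inj₂ _) (inj₁ _) → yes tt
                 ; (inj₂ _) (inj₂ _) → no λ () }
  ; ~-sym    = λ { {inj₁ _} {inj₂ _} _ → tt
                 ; {inj₂ _} {inj₁ _} _ → tt }
  ; ~-irrefl = λ { {inj₁ _} refl ()
                 ; {inj₂ _} refl () }
  }
  where
  _~_ : Rel (Fin a ⊎ Fin b) 0ℓ
  inj₁ _ ~ inj₁ _ = ⊥
  inj₁ _ ~ inj₂ _ = ⊤
  inj₂ _ ~ inj₁ _ = ⊤
  inj₂ _ ~ inj₂ _ = ⊥

-- Only edges are colored, so an edgeless graph has a coloring with 0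
-- colors.  `unoriented` makes the color a function of the edge {u,v}; it
-- also forces independence of the proof of adjacency.  In `rainbow`,
-- a ≢ c and b ≢ d suffice for a, b, c, d to be pairwise distinct.
record BColoring {n} (G : Graph (Fin n)) (k : ℕ) : Set where
  open Graph G
  field
    color      : ∀ {u v} → u ~ v → Fin k
    unoriented : ∀ {u v} (e : u ~ v) (f : v ~ u) → color e ≡ color f
    proper     : ∀ {u v w} (e : u ~ v) (f : u ~ w) → v ≢ w → color e ≢ color f
    rainbow    : ∀ {a b c d} (ab : a ~ b) (bc : b ~ c) (cd : c ~ d) (da : d ~ a) →
                 a ≢ c → b ≢ d →
                 Unique (color ab ∷ color bc ∷ color cd ∷ color da ∷ [])

least : ∀ {P : U.Pred ℕ 0ℓ} → U.Decidable P → ∀ n → P n →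
        ∃[ m ] P m × (∀ {k} → P k → m ≤ k)
least P? zero    p = zero , p , λ _ → z≤n
least P? (suc n) p with P? zero
... | yes p₀ = zero , p₀ , λ _ → z≤n
... | no ¬p₀ with least (P? ∘ suc) n p
...   | m , pm , min = suc m , pm , λ { {zero}  q → contradiction q ¬p₀
                                      ; {suc _} q → s≤s (min q) }

module _ {n} (G : Graph (Fin n)) where
  open Graph G

  private

    -- Total colorings Fin n → Fin n → Fin k are coded by elements of
    -- Fin (k ^ (n * n)), so that the search for a coloring is finite.
    decode : ∀ {k} → Fin (k ℕ.^ (n ℕ.* n)) → Fin n → Fin n → Fin k
    decode i u v = finToFun i (combine u v)

    encode : ∀ {k} → (Fin n → Fin n → Fin k) → Fin (k ℕ.^ (n ℕ.* n))
    encode c = funToFin (λ x → uncurry c (remQuot n x))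

    decode-encode : ∀ {k} (c : Fin n → Fin n → Fin k) u v →
                    decode (encode c) u v ≡ c u v
    decode-encode c u v = trans
      (finToFun-funToFin (λ x → uncurry c (remQuot n x)) (combine u v))
      (cong (uncurry c) (remQuot-combine u v))

    Good : ∀ {k} → (Fin n → Fin n → Fin k) → Set
    Good c =
      (∀ u v → u ~ v → c u v ≡ c v u) ×
      (∀ u v w → u ~ v → u ~ w → v ≢ w → c u v ≢ c u w) ×
      (∀ x y z t → x ~ y → y ~ z → z ~ t → t ~ x → x ≢ z → y ≢ t →
        Unique (c x y ∷ c y z ∷ c z t ∷ c t x ∷ []))

    good? : ∀ {k} (c : Fin n → Fin n → Fin k) → Dec (Good c)
    good? c =
      all′ (λ u → all′ λ v → (u ~? v) →-dec (c u v ≟ c v u))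
      ×-dec
      all′ (λ u → all′ λ v → all′ λ w →
        (u ~? v) →-dec (u ~? w) →-dec ¬? (v ≟ w) →-dec ¬? (c u v ≟ c u w))
      ×-dec
      all′ (λ x → all′ λ y → all′ λ z → all′ λ t →
        (x ~? y) →-dec (y ~? z) →-dec (z ~? t) →-dec (t ~? x) →-dec
        ¬? (x ≟ z) →-dec ¬? (y ≟ t) →-dec DecUnique.unique? _≟_ _)
      where
      all′ : ∀ {P : U.Pred (Fin n) 0ℓ} → U.Decidable P → Dec (∀ v → P v)
      all′ = all?

    fromGood : ∀ {k} (c : Fin n → Fin n → Fin k) → Good c → BColoring G k
    fromGood c (s , p , r) = record
      { color      = λ {u} {v} _ → c u v
      ; unoriented = λ e _ → s _ _ e
      ; proper     = p _ _ _
      ; rainbow    = r _ _ _ _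
      }

    toGood : ∀ {k} → BColoring G (suc k) → ∃[ i ] Good (decode {suc k} i)
    toGood {k} B = encode c
      , (λ u v e → trans (c≡ e) (trans (unoriented e (~-sym e)) (sym (c≡ (~-sym e)))))
      , (λ u v w e f v≢w eq → proper e f v≢w (trans (sym (c≡ e)) (trans eq (c≡ f))))
      , goodRainbow
      where
      open BColoring B
      c : Fin n → Fin n → Fin (suc k)
      c u v with u ~? v
      ... | yes e = color e
      ... | no  _ = zero
      c₀ : ∀ {u v} (e : u ~ v) → c u v ≡ color e
      c₀ {u} {v} e with u ~? v
      ... | yes e′ = trans (unoriented e′ (~-sym e)) (sym (unoriented e (~-sym e)))
      ... | no ¬e  = contradiction e ¬e
      c≡ : ∀ {u v} (e : u ~ v) → decode (encode c) u v ≡ color e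
      c≡ e = trans (decode-encode c _ _) (c₀ e)
      goodRainbow : ∀ x y z t → x ~ y → y ~ z → z ~ t → t ~ x → x ≢ z → y ≢ t →
                    let c′ = decode (encode c) in
                    Unique (c′ x y ∷ c′ y z ∷ c′ z t ∷ c′ t x ∷ [])
      goodRainbow x y z t e f g h p q
        rewrite c≡ e | c≡ f | c≡ g | c≡ h = rainbow e f g h p q

  BColoring? : U.Decidable (BColoring G)
  BColoring? zero = map′ to from (all? λ u → all? λ v → ¬? (u ~? v))
    where
    to : (∀ u v → ¬ (u ~ v)) → BColoring G zero
    to ¬e = record
      { color      = λ e → ⊥-elim (¬e _ _ e)
      ; unoriented = λ e → ⊥-elim (¬e _ _ e)
      ; proper     = λ e → ⊥-elim (¬e _ _ e)
      ; rainbow    = λ e → ⊥-elim (¬e _ _ e)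
      }
    from : BColoring G zero → ∀ u v → ¬ (u ~ v)
    from B u v e with BColoring.color B e
    ... | ()
  BColoring? (suc k) =
    map′ (λ (i , g) → fromGood (decode i) g) toGood
         (any? {n = suc k ℕ.^ (n ℕ.* n)} λ i → good? (decode i))

  private

    pair : Fin n → Fin n → Fin (n ℕ.* n)
    pair u v with u ≤? v
    ... | yes _ = combine u v
    ... | no  _ = combine v u

    pair-sym : ∀ u v → pair u v ≡ pair v u
    pair-sym u v with u ≤? v | v ≤? u
    ... | yes p | yes q rewrite ≤-antisym p q = refl
    ... | yes _ | no  _ = refl
    ... | no  _ | yes _ = refl
    ... | no ¬p | no ¬q with ≤-total u v
    ...   | inj₁ p = contradiction p ¬p
    ...   | inj₂ q = contradiction q ¬q

    pair-injective : ∀ u v u′ v′ → pair u v ≡ pair u′ v′ →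
                     (u ≡ u′ × v ≡ v′) ⊎ (u ≡ v′ × v ≡ u′)
    pair-injective u v u′ v′ eq with u ≤? v | u′ ≤? v′
    ... | yes _ | yes _ = inj₁ (combine-injective u v u′ v′ eq)
    ... | yes _ | no  _ = inj₂ (combine-injective u v v′ u′ eq)
    ... | no  _ | yes _ with combine-injective v u u′ v′ eq
    ...   | p , q = inj₂ (q , p)
    pair-injective u v u′ v′ eq | no _ | no _ with combine-injective v u v′ u′ eq
    ...   | p , q = inj₁ (q , p)

    adjacent : ∀ {u v w} → u ~ v → u ≢ w → pair u v ≢ pair v w
    adjacent {u} {v} {w} e u≢w eq with pair-injective u v v w eq
    ... | inj₁ (u≡v , _) = ~-irrefl u≡v e
    ... | inj₂ (u≡w , _) = u≢w u≡w

    opposite : ∀ {a b c d} → a ≢ c → d ~ a → pair a b ≢ pair c d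
    opposite {a} {b} {c} {d} a≢c da eq with pair-injective a b c d eq
    ... | inj₁ (a≡c , _) = a≢c a≡c
    ... | inj₂ (a≡d , _) = ~-irrefl (sym a≡d) da

  -- All edges get different colors.
  trivialColoring : BColoring G (n ℕ.* n)
  trivialColoring = record
    { color      = λ {u} {v} _ → pair u v
    ; unoriented = λ {u} {v} _ _ → pair-sym u v
    ; proper     = λ {u} {v} {w} e f v≢w eq →
        adjacent (~-sym e) v≢w (trans (pair-sym v u) eq)
    ; rainbow    = λ {a} {b} {c} {d} ab bc cd da a≢c b≢d →
          (adjacent ab a≢c ∷ opposite a≢c da ∷
            (λ eq → adjacent da (b≢d ∘ sym) (sym eq)) ∷ [])
        ∷ (adjacent bc b≢d ∷ opposite b≢d ab ∷ [])
        ∷ (adjacent cd (a≢c ∘ sym) ∷ [])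
        ∷ [] ∷ []
    }

  -- q_B-coloring and q_B-minimal below characterize this number.
  q_B : ℕ
  q_B = proj₁ (least BColoring? (n ℕ.* n) trivialColoring)

  q_B-coloring : BColoring G q_B
  q_B-coloring = proj₁ (proj₂ (least BColoring? (n ℕ.* n) trivialColoring))

  q_B-minimal : ∀ {k} → BColoring G k → q_B ≤ k
  q_B-minimal = proj₂ (proj₂ (least BColoring? (n ℕ.* n) trivialColoring))

{-# OPTIONS --safe #-}
module Submission where

-- Colour the edges greedily along a degeneracy order, vertex by vertex.  Let v be the
-- current vertex, B its at most d earlier neighbours, and u ∈ B.  Every earlier edge
-- that must differ in colour from vu has the form wx with x ∈ B and w a common
-- neighbour of u and x, so there are fewer than Σ_{x ∈ B} |N(u) ∩ N(x)| of them.  With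
-- dΔ − s − 1 colours the greedy colouring must get stuck, whence dΔ − s is at most
-- this sum.  Each summand is at most Δ and s < Δ, so |B| = d and the summands fall short
-- of Δ by at most s in total.  Hence at least Δ − s vertices of N(u) are adjacent to all
-- of B, and at least d − s of the x ∈ B attain |N(u) ∩ N(x)| = Δ, that is N(x) = N(u).

open import Defs
open import Data.Nat.Base using (ℕ; _*_; _∸_; _≤_; _<_)
open import Data.Fin.Base using (Fin)
open import Data.Product.Base using (_×_)

open import Data.Bool.Base using (true; false)
open import Data.Fin.Base using (inject≤; fromℕ<) renaming (zero to fzero; suc to fsuc)
open import Data.Fin.Properties as Fin using (any?)
open import Data.Fin.Subset as Subset using (Subset; ⊤; ∣_∣)
open import Data.Fin.Subset.Properties
  using (nonempty?; x∈p∧x≢y⇒x∈p-y; x∈p⇒∣p-x∣<∣p∣; p─q⊆p; ∈⊤; _∈?_)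
open import Data.List.Base using (List; []; _∷_; _++_; length; map; filter; lookup; foldr; concatMap; allFin)
open import Data.List.Extrema.Nat using (xs≤max)
open import Data.List.Membership.Propositional using (_∈_; _∉_; lose)
open import Data.List.Membership.Propositional.Properties
  using (∈-filter⁺; ∈-filter⁻; ∈-map⁺; ∈-map⁻; ∈-allFin; ∈-upTo⁻; ∈-++⁺ˡ; ∈-++⁺ʳ; ∈-++⁻;
         ∈-lookup; ∈-concatMap⁺)
import Data.List.Membership.Setoid as SetoidMembership
import Data.List.Membership.Setoid.Properties as SetoidMembershipₚ
open import Data.List.Properties using (length-++; length-map; length-filter; filter-notAll; length-upTo)
open import Data.List.Relation.Binary.Sublist.Propositional using (_⊆_; []; _∷_; _∷ʳ_; ⊆-refl; ⊆-trans)
open import Data.List.Relation.Binary.Sublist.Propositional.Properties using (filter-⊆)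
open import Data.List.Relation.Unary.All as All using (All; []; _∷_)
import Data.List.Relation.Unary.All.Properties as All
open import Data.List.Relation.Unary.AllPairs as AllPairs using (AllPairs; []; _∷_)
import Data.List.Relation.Unary.AllPairs.Properties as AllPairs
open import Data.List.Relation.Unary.Any as Any using (Any; here; there)
open import Data.List.Relation.Unary.Unique.Propositional using (Unique)
import Data.List.Relation.Unary.Unique.Propositional.Properties as Unique
import Data.List.Relation.Unary.Unique.Setoid as SetoidUnique
open import Data.Nat.Base using (zero; suc; _+_; z≤n; s≤s)
open import Data.Nat.ListAction using (sum)
open import Data.Nat.Properties
open import Data.Nat.Solver using (module +-*-Solver)
open import Data.List.Membership.DecPropositional _≟_ using () renaming (_∈?_ to _∈ℕ?_)
open import Data.Product.Base using (∃-syntax; _,_; proj₁; proj₂; swap)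
open import Data.Product.Properties using (≡-dec)
open import Data.Sum.Base using (_⊎_; inj₁; inj₂)
open import Data.Vec.Base as Vec using (tabulate)
open import Data.Vec.Properties using ([]=⇒lookup; lookup⇒[]=; lookup∘tabulate)
open import Function.Base using (_∘_; id; const)
open import Function.Bundles using (mk⇔)
open import Function.Definitions using (Injective)
open import Level using (0ℓ)
open import Relation.Binary.Bundles using (Setoid; DecSetoid)
open import Relation.Binary.Core using (Rel)
open import Relation.Binary.Definitions using (Decidable; Symmetric)
open import Relation.Binary.PropositionalEquality
  using (_≡_; _≢_; refl; sym; trans; cong; cong₂; subst; subst₂; setoid)
open import Relation.Nullary.Decidable
  using (Dec; yes; no; does; map′; ¬?; _×-dec_; _⊎-dec_; decidable-stable; dec-true)
open import Relation.Nullary.Negation using (¬_; contradiction)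
import Relation.Unary as U

open +-*-Solver using (solve; _:+_; _:=_; con)

-- Pigeonhole arguments and counting on lists.

module _ (S : Setoid 0ℓ 0ℓ) where
  open Setoid S using (_≈_) renaming (sym to ≈-sym)
  open SetoidMembership S using () renaming (_∈_ to _∈ₛ_)

  Unique-lookup-injective : ∀ {xs} → SetoidUnique.Unique S xs → ∀ i j →
                            lookup xs i ≈ lookup xs j → i ≡ j
  Unique-lookup-injective (x∉ ∷ _)   fzero    fzero    _  = refl
  Unique-lookup-injective (x∉ ∷ _)   fzero    (fsuc j) eq = contradiction eq (All.lookup x∉ (∈-lookup j))
  Unique-lookup-injective (x∉ ∷ _)   (fsuc i) fzero    eq = contradiction (≈-sym eq) (All.lookup x∉ (∈-lookup i))
  Unique-lookup-injective (_  ∷ xs!) (fsuc i) (fsuc j) eq = cong fsuc (Unique-lookup-injective xs! i j eq)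

  -- Sending a position of `xs` to the position of a matching entry of `ys` is injective. A setoid
  -- is allowed because edges are compared up to reversal.
  Unique-⊆⇒length≤ : ∀ {xs ys} → SetoidUnique.Unique S xs → All (_∈ₛ ys) xs → length xs ≤ length ys
  Unique-⊆⇒length≤ {xs} {ys} xs! xs⊆ys = Fin.injective⇒≤ {f = λ i → Any.index (mem i)} λ {i} {j} eq →
    Unique-lookup-injective xs! i j (SetoidMembershipₚ.index-injective S (mem i) (mem j) eq)
    where
    mem : ∀ i → lookup xs i ∈ₛ ys
    mem i = All.lookup xs⊆ys (∈-lookup i)

AllPairs-lookup : {A : Set} {R : Rel A 0ℓ} → Symmetric R → ∀ {xs} → AllPairs R xs →
                  ∀ {x y} → x ∈ xs → y ∈ xs → x ≡ y ⊎ R x y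
AllPairs-lookup R-sym (_  ∷ _) (here refl) (here refl) = inj₁ refl
AllPairs-lookup R-sym (Rx ∷ _) (here refl) (there y∈)  = inj₂ (All.lookup Rx y∈)
AllPairs-lookup R-sym (Rx ∷ _) (there x∈)  (here refl) = inj₂ (R-sym (All.lookup Rx x∈))
AllPairs-lookup R-sym (_ ∷ Rs) (there x∈)  (there y∈)  = AllPairs-lookup R-sym Rs x∈ y∈

-- If every number below `k` occurred in `xs`, the k distinct entries of `upTo k` would fit into
-- fewer than k places.
fresh : ∀ {k} (xs : List ℕ) → length xs < k → ∃[ i ] i < k × i ∉ xs
fresh {k} xs xs<k with anyUpTo? (λ i → ¬? (i ∈ℕ? xs)) k
... | yes found = found
... | no  none  = contradiction xs<k (≤⇒≯ (subst (_≤ length xs) (length-upTo k)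
  (Unique-⊆⇒length≤ (setoid ℕ) (Unique.upTo⁺ k)
    (All.tabulate λ i∈ → decidable-stable (_ ∈ℕ? xs) λ i∉ → none (_ , ∈-upTo⁻ i∈ , i∉)))))

module _ {A : Set} {P : U.Pred A 0ℓ} (P? : U.Decidable P) where

  -- In terms of complements: `P` fails in `xs` at most as often as in `ys`. The additive form
  -- avoids truncated subtraction.
  length-filter-⊆ : ∀ {xs ys} → xs ⊆ ys → length (filter P? ys) + length xs ≤ length ys + length (filter P? xs)
  length-filter-⊆ [] = z≤n
  length-filter-⊆ (y ∷ʳ xs⊆ys) with does (P? y)
  ... | true  = s≤s (length-filter-⊆ xs⊆ys)
  ... | false = m≤n⇒m≤1+n (length-filter-⊆ xs⊆ys)
  length-filter-⊆ {x ∷ xs} {x ∷ ys} (refl ∷ xs⊆ys) with does (P? x)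
  ... | true  = s≤s (subst₂ _≤_ (sym (+-suc (length (filter P? ys)) (length xs)))
                                (sym (+-suc (length ys) (length (filter P? xs))))
                                (s≤s (length-filter-⊆ xs⊆ys)))
  ... | false = subst (_≤ suc (length ys + length (filter P? xs)))
                      (sym (+-suc (length (filter P? ys)) (length xs)))
                      (s≤s (length-filter-⊆ xs⊆ys))

module _ {A : Set} (f : A → ℕ) {m : ℕ} (f≤m : ∀ x → f x ≤ m) where

  sum≤length* : ∀ xs → sum (map f xs) ≤ length xs * m
  sum≤length* []       = z≤n
  sum≤length* (x ∷ xs) = +-mono-≤ (f≤m x) (sum≤length* xs)

  -- A summand that is not full falls short of `m` by at least one, so the total deficit bounds the
  -- number of entries that are not full.
  sum+length≤ : (full? : U.Decidable (λ x → m ≤ f x)) → ∀ xs →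
                sum (map f xs) + length xs ≤ length xs * m + length (filter full? xs)
  sum+length≤ full? []       = z≤n
  sum+length≤ full? (x ∷ xs) with full? x | sum+length≤ full? xs
  ... | yes _   | ih = subst₂ _≤_
    (regroup (f x) (sum (map f xs)) (length xs))
    (regroup m (length xs * m) (length (filter full? xs)))
    (+-mono-≤ (f≤m x) (s≤s ih))
    where
    regroup : ∀ a b c → a + suc (b + c) ≡ (a + b) + suc c
    regroup = solve 3 (λ a b c → a :+ (con 1 :+ (b :+ c)) := (a :+ b) :+ (con 1 :+ c)) refl
  ... | no m≰fx | ih = subst₂ _≤_
    (solve 3 (λ a b c → (con 1 :+ a) :+ (b :+ c) := (a :+ b) :+ (con 1 :+ c)) refl (f x) (sum (map f xs)) (length xs))
    (sym (+-assoc m (length xs * m) _))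
    (+-mono-≤ (≰⇒> m≰fx) ih)

-- Greedy colouring for a decidable clash relation.

module Greedy (D : DecSetoid 0ℓ 0ℓ) {Clash : Rel (DecSetoid.Carrier D) 0ℓ} (clash? : Decidable Clash) (k : ℕ) where
  open DecSetoid D using (_≈_) renaming (Carrier to E; _≟_ to _≈?_; refl to ≈-refl; sym to ≈-sym; trans to ≈-trans)
  open SetoidUnique (DecSetoid.setoid D) using () renaming (Unique to Unique≈)

  -- `colour` is total on `E` and takes values in ℕ, so that a default value exists even when `k` is
  -- 0; only listed elements are bounded and separated.
  record Colouring (es : List E) : Set where
    field
      colour    : E → ℕ
      cong-≈    : ∀ {e f} → e ≈ f → colour e ≡ colour f
      bounded   : All (λ e → colour e < k) es
      separates : AllPairs (λ e f → Clash e f → colour e ≢ colour f) es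

  empty : Colouring []
  empty = record { colour = const 0 ; cong-≈ = λ _ → refl ; bounded = [] ; separates = [] }

  -- The clashing elements block fewer than `k` colours, so one stays free. The whole `≈`-class of
  -- `e` receives it, which preserves `cong-≈`; no element of `es` lies in that class, so the old
  -- colours survive on `es`.
  extend : ∀ {e es} → Unique≈ (e ∷ es) → length (filter (clash? e) es) < k → Colouring es → Colouring (e ∷ es)
  extend {e} {es} (e∉es ∷ _) few C = go (fresh (map C.colour (filter (clash? e) es))
                                              (subst (_< k) (sym (length-map C.colour (filter (clash? e) es))) few))
    where
    module C = Colouring C
    go : ∃[ i ] i < k × i ∉ map C.colour (filter (clash? e) es) → Colouring (e ∷ es)
    go (i , i<k , i∉) = record
      { colour    = colour
      ; cong-≈    = colour-cong
      ; bounded   = subst (_< k) (sym new) i<k ∷ All.tabulate λ f∈ → subst (_< k) (sym (old f∈)) (All.lookup C.bounded f∈)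
      ; separates = All.tabulate (λ f∈ clash eq → i∉ (subst (_∈ _) (trans (sym (old f∈)) (trans (sym eq) new))
                                     (∈-map⁺ C.colour (∈-filter⁺ (clash? e) f∈ clash))))
                  ∷ keep C.separates (All.tabulate old)
      }
      where
      colour : E → ℕ
      colour f with e ≈? f
      ... | yes _ = i
      ... | no  _ = C.colour f

      colour-cong : ∀ {f g} → f ≈ g → colour f ≡ colour g
      colour-cong {f} {g} f≈g with e ≈? f | e ≈? g
      ... | yes _   | yes _   = refl
      ... | yes e≈f | no  e≉g = contradiction (≈-trans e≈f f≈g) e≉g
      ... | no  e≉f | yes e≈g = contradiction (≈-trans e≈g (≈-sym f≈g)) e≉f
      ... | no  _   | no  _   = C.cong-≈ f≈g

      new : colour e ≡ i
      new with e ≈? e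
      ... | yes _   = refl
      ... | no  e≉e = contradiction ≈-refl e≉e

      old : ∀ {f} → f ∈ es → colour f ≡ C.colour f
      old {f} f∈ with e ≈? f
      ... | yes e≈f = contradiction e≈f (All.lookup e∉es f∈)
      ... | no  _   = refl

      keep : ∀ {fs} → AllPairs (λ f g → Clash f g → C.colour f ≢ C.colour g) fs →
             All (λ f → colour f ≡ C.colour f) fs →
             AllPairs (λ f g → Clash f g → colour f ≢ colour g) fs
      keep []        []        = []
      keep (p ∷ ps) (q ∷ qs) =
        All.zipWith (λ { (sep , r) cl eq → sep cl (trans (sym q) (trans eq r)) }) (p , qs) ∷ keep ps qs

-- Subsets and copies of graphs.

x∉p-x : ∀ {m} (p : Subset m) x → x Subset.∉ (p Subset.- x)
x∉p-x (_ Vec.∷ p) fzero    ()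
x∉p-x (_ Vec.∷ p) (fsuc x) (Vec.there x∈) = x∉p-x p x x∈

module _ {V : Set} {n} {G : Graph (Fin n)} {K : Graph V} where
  private
    module G = Graph G
    module K = Graph K

  -- The subgraph has only the images of the edges of `K`, so further edges of `G` inside the image
  -- do not disturb `adjacency`. Deciding the image turns it into a `Subset` and reduces adjacency
  -- in the subgraph to adjacency in `K`.
  embedding⇒copy : (φ : V → Fin n) → Injective _≡_ _≡_ φ → (∀ v → Dec (∃[ x ] φ x ≡ v)) →
                   (∀ {x y} → x K.~ y → φ x G.~ φ y) → ContainsCopy G K
  embedding⇒copy φ φ-inj image? hom = H , record
    { to         = φ
    ; injective  = φ-inj
    ; to-∈       = λ x → ∈-image (x , refl)
    ; surjective = image-∈
    ; adjacency  = mk⇔ (λ x~y → _ , _ , refl , refl , x~y)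
                       λ { (x , y , p , q , x~y) → subst₂ K._~_ (φ-inj p) (φ-inj q) x~y }
    }
    where
    image : Subset n
    image = tabulate (does ∘ image?)

    ∈-image : ∀ {v} → (∃[ x ] φ x ≡ v) → v Subset.∈ image
    ∈-image {v} x = lookup⇒[]= v image (trans (lookup∘tabulate _ v) (dec-true (image? v) x))

    image-∈ : ∀ {v} → v Subset.∈ image → ∃[ x ] φ x ≡ v
    image-∈ {v} v∈ with image? v | trans (sym (lookup∘tabulate (does ∘ image?) v)) ([]=⇒lookup v∈)
    ... | yes x | _ = x

    _~_ : Rel (Fin n) 0ℓ
    u ~ v = ∃[ x ] ∃[ y ] φ x ≡ u × φ y ≡ v × x K.~ y

    _~?_ : Decidable _~_
    u ~? v with image? u | image? v
    ... | no ¬u         | _             = no λ { (x , _ , p , _) → ¬u (x , p) }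
    ... | yes _         | no ¬v         = no λ { (_ , y , _ , q , _) → ¬v (y , q) }
    ... | yes (x , p) | yes (y , q) = map′ (λ x~y → x , y , p , q , x~y)
      (λ { (x′ , y′ , p′ , q′ , x~y) → subst₂ K._~_ (φ-inj (trans p′ (sym p))) (φ-inj (trans q′ (sym q))) x~y })
      (x K.~? y)

    H : Subgraph G
    H = record
      { vertices = image
      ; edges    = record
        { _~_      = _~_
        ; _~?_     = _~?_
        ; ~-sym    = λ { (x , y , p , q , x~y) → y , x , q , p , K.~-sym x~y }
        ; ~-irrefl = λ { refl (x , y , p , q , x~y) → K.~-irrefl (φ-inj (trans p (sym q))) x~y }
        }
      ; ~⇒∈      = λ { (x , y , p , q , _) → ∈-image (x , p) , ∈-image (y , q) }
      ; ~⇒~      = λ { (x , y , p , q , x~y) → subst₂ G._~_ p q (hom x~y) }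
      }

module _ {n} (G : Graph (Fin n)) where
  open Graph G

  -- A vertex on both sides would be adjacent to itself, so the two lists are disjoint. Surplus
  -- vertices are dropped through `inject≤`.
  bipartite-copy : ∀ {a b} {xs ys : List (Fin n)} → Unique xs → Unique ys → a ≤ length xs → b ≤ length ys →
                   (∀ {x y} → x ∈ xs → y ∈ ys → x ~ y) → ContainsCopy G K[ a , b ]
  bipartite-copy {a} {b} {xs} {ys} xs! ys! a≤ b≤ joined = embedding⇒copy φ φ-inj image? hom
    where
    left : Fin a → Fin n
    left i = lookup xs (inject≤ i a≤)

    right : Fin b → Fin n
    right j = lookup ys (inject≤ j b≤)

    left~right : ∀ i j → left i ~ right j
    left~right i j = joined (∈-lookup _) (∈-lookup _)

    φ : Fin a ⊎ Fin b → Fin n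
    φ (inj₁ i) = left i
    φ (inj₂ j) = right j

    φ-inj : Injective _≡_ _≡_ φ
    φ-inj {inj₁ i} {inj₁ j} eq = cong inj₁ (Fin.inject≤-injective a≤ a≤ i j (Unique-lookup-injective (setoid _) xs! _ _ eq))
    φ-inj {inj₁ i} {inj₂ j} eq = contradiction (left~right i j) (~-irrefl eq)
    φ-inj {inj₂ i} {inj₁ j} eq = contradiction (left~right j i) (~-irrefl (sym eq))
    φ-inj {inj₂ i} {inj₂ j} eq = cong inj₂ (Fin.inject≤-injective b≤ b≤ i j (Unique-lookup-injective (setoid _) ys! _ _ eq))

    image? : ∀ v → Dec (∃[ x ] φ x ≡ v)
    image? v = map′ (λ { (inj₁ (i , p)) → inj₁ i , p ; (inj₂ (j , p)) → inj₂ j , p })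
                    (λ { (inj₁ i , p) → inj₁ (i , p) ; (inj₂ j , p) → inj₂ (j , p) })
                    (any? (λ i → left i Fin.≟ v) ⊎-dec any? (λ j → right j Fin.≟ v))

    hom : ∀ {x y} → Graph._~_ K[ a , b ] x y → φ x ~ φ y
    hom {inj₁ i} {inj₂ j} _ = left~right i j
    hom {inj₂ i} {inj₁ j} _ = ~-sym (left~right j i)

  -- Degeneracy orders.

  -- The head of the list is removed first, hence coloured last.
  data EliminationOrder (d : ℕ) : List (Fin n) → Set where
    []  : EliminationOrder d []
    _∷_ : ∀ {v ws} → length (filter (v ~?_) ws) ≤ d → EliminationOrder d ws → EliminationOrder d (v ∷ ws)

  induced : Subset n → Subgraph G
  induced S = record
    { vertices = S
    ; edges    = record
      { _~_      = λ u v → u Subset.∈ S × v Subset.∈ S × u ~ v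
      ; _~?_     = λ u v → (u ∈? S) ×-dec (v ∈? S) ×-dec (u ~? v)
      ; ~-sym    = λ { (p , q , e) → q , p , ~-sym e }
      ; ~-irrefl = λ { refl (_ , _ , e) → ~-irrefl refl e }
      }
    ; ~⇒∈      = λ { (p , q , _) → p , q }
    ; ~⇒~      = λ { (_ , _ , e) → e }
    }

  -- Degeneracy, applied to the subgraph induced on `S`, supplies a vertex with at most d neighbours
  -- in `S`; it heads the list, and recursion orders the rest. The bound `m` makes the recursion
  -- structural. Since the tail stays inside `S`, neighbours in the tail are neighbours in the
  -- induced subgraph.
  eliminationOrder : ∀ {d} → Degenerate d G → ∀ m (S : Subset n) → ∣ S ∣ ≤ m →
    ∃[ vs ] Unique vs × EliminationOrder d vs × (∀ {v} → v Subset.∈ S → v ∈ vs) × (∀ {v} → v ∈ vs → v Subset.∈ S)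
  eliminationOrder {d} deg m S ∣S∣≤m with nonempty? S
  ... | no  S-empty = [] , [] , [] , (λ v∈ → contradiction (_ , v∈) S-empty) , λ ()
  ... | yes S-nonempty with deg (induced S) S-nonempty
  eliminationOrder {d} deg zero S ∣S∣≤m | yes _ | v , v∈S , _ =
    contradiction (≤-trans (x∈p⇒∣p-x∣<∣p∣ v∈S) ∣S∣≤m) λ ()
  eliminationOrder {d} deg (suc m) S ∣S∣≤m | yes _ | v , v∈S , few =
    let ws , ws! , order , S-v⊆ws , ws⊆S-v = eliminationOrder deg m (S Subset.- v)
                                               (≤-pred (≤-trans (x∈p⇒∣p-x∣<∣p∣ v∈S) ∣S∣≤m))
        ws⊆S : ∀ {w} → w ∈ ws → w Subset.∈ S
        ws⊆S w∈ = p─q⊆p S _ (ws⊆S-v w∈)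
    in v ∷ ws
     , All.tabulate (λ { w∈ refl → x∉p-x S v (ws⊆S-v w∈) }) ∷ ws!
     , ≤-trans (Unique-⊆⇒length≤ (setoid _) (Unique.filter⁺ (v ~?_) ws!) (All.tabulate λ w∈ →
         let w∈ws , v~w = ∈-filter⁻ (v ~?_) {xs = ws} w∈
         in ∈-filter⁺ (Graph._~?_ (Subgraph.edges (induced S)) v) (∈-allFin _) (v∈S , ws⊆S w∈ws , v~w))) few
       ∷ order
     , (λ {w} w∈S → case-≟ w w∈S S-v⊆ws)
     , λ { (here refl) → v∈S ; (there w∈) → ws⊆S w∈ }
    where
    case-≟ : ∀ w {ws} → w Subset.∈ S → (∀ {x} → x Subset.∈ S Subset.- v → x ∈ ws) → w ∈ v ∷ ws
    case-≟ w w∈S S-v⊆ws with w Fin.≟ v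
    ... | yes refl = here refl
    ... | no  w≢v  = there (S-v⊆ws (x∈p∧x≢y⇒x∈p-y w∈S w≢v))

  -- Edges up to reversal and the clash relation.

  Edge : Set
  Edge = Fin n × Fin n

  infix 4 _≈_

  _≈_ : Rel Edge 0ℓ
  e ≈ f = e ≡ f ⊎ e ≡ swap f

  ≈-decSetoid : DecSetoid 0ℓ 0ℓ
  ≈-decSetoid = record
    { Carrier          = Edge
    ; _≈_              = _≈_
    ; isDecEquivalence = record
      { isEquivalence = record
        { refl  = inj₁ refl
        ; sym   = λ { (inj₁ refl) → inj₁ refl ; (inj₂ refl) → inj₂ refl }
        ; trans = λ { (inj₁ refl) q → q
                    ; (inj₂ refl) (inj₁ refl) → inj₂ refl
                    ; (inj₂ refl) (inj₂ refl) → inj₁ refl }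
        }
      ; _≟_ = λ e f → ≡-dec Fin._≟_ Fin._≟_ e f ⊎-dec ≡-dec Fin._≟_ Fin._≟_ e (swap f)
      }
    }

  -- Two edges clash when they are opposite on a closed walk of length 4.  As
  -- such walks may backtrack, this covers incident edges as well as opposite edges
  -- of a 4-cycle, and no other pairs of
  -- distinct edges.
  Clash : Rel Edge 0ℓ
  Clash (a , b) (c , d) = (a ~ c × b ~ d) ⊎ (a ~ d × b ~ c)

  clash? : Decidable Clash
  clash? (a , b) (c , d) = ((a ~? c) ×-dec (b ~? d)) ⊎-dec ((a ~? d) ×-dec (b ~? c))

  Clash-sym : Symmetric Clash
  Clash-sym (inj₁ (p , q)) = inj₁ (~-sym p , ~-sym q)
  Clash-sym (inj₂ (p , q)) = inj₂ (~-sym q , ~-sym p)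

  Clash-respʳ-≈ : ∀ {e f g} → f ≈ g → Clash e g → Clash e f
  Clash-respʳ-≈ (inj₁ refl) cl       = cl
  Clash-respʳ-≈ (inj₂ refl) (inj₁ p) = inj₂ p
  Clash-respʳ-≈ (inj₂ refl) (inj₂ p) = inj₁ p

  open SetoidUnique (DecSetoid.setoid ≈-decSetoid) using () renaming (Unique to Unique≈)
  open SetoidMembership (DecSetoid.setoid ≈-decSetoid) using () renaming (_∈_ to _∈≈_)

  star : Fin n → List (Fin n) → List Edge
  star v = map (v ,_)

  -- Every edge points from a vertex to one that occurs later in the list.
  edgesOf : List (Fin n) → List Edge
  edgesOf []       = []
  edgesOf (v ∷ ws) = star v (filter (v ~?_) ws) ++ edgesOf ws

  edgesOf-∈ : ∀ vs {w x} → (w , x) ∈ edgesOf vs → w ∈ vs × x ∈ vs × w ~ x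
  edgesOf-∈ (v ∷ ws) e∈ with ∈-++⁻ (star v (filter (v ~?_) ws)) e∈
  ... | inj₂ e∈ws = let w∈ , x∈ , w~x = edgesOf-∈ ws e∈ws in there w∈ , there x∈ , w~x
  ... | inj₁ e∈v with ∈-map⁻ (v ,_) e∈v
  ...   | x , x∈ , refl = let x∈ws , v~x = ∈-filter⁻ (v ~?_) {xs = ws} x∈ in here refl , there x∈ws , v~x

  edgesOf-complete : ∀ vs {a b} → a ∈ vs → b ∈ vs → a ~ b → ∃[ e ] e ∈ edgesOf vs × e ≈ (a , b)
  edgesOf-complete (v ∷ ws) (here refl) (here refl) a~b = contradiction a~b (~-irrefl refl)
  edgesOf-complete (v ∷ ws) (here refl) (there b∈) a~b =
    _ , ∈-++⁺ˡ (∈-map⁺ (v ,_) (∈-filter⁺ (v ~?_) b∈ a~b)) , inj₁ refl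
  edgesOf-complete (v ∷ ws) (there a∈) (here refl) a~b =
    _ , ∈-++⁺ˡ (∈-map⁺ (v ,_) (∈-filter⁺ (v ~?_) a∈ (~-sym a~b))) , inj₂ refl
  edgesOf-complete (v ∷ ws) (there a∈) (there b∈) a~b =
    let e , e∈ , e≈ = edgesOf-complete ws a∈ b∈ a~b in e , ∈-++⁺ʳ (star v (filter (v ~?_) ws)) e∈ , e≈

  -- No edge of `edgesOf ws` meets `v`. The list `us` is arbitrary because the star at `v` is
  -- coloured one edge at a time.
  star-++-unique : ∀ {v ws us} → All (v ≢_) ws → Unique us → Unique≈ (edgesOf ws) → Unique≈ (star v us ++ edgesOf ws)
  star-++-unique {v} {ws} v∉ us! ws! = AllPairs.++⁺
    (AllPairs.map⁺ (AllPairs.map (λ { u≢u′ (inj₁ refl) → u≢u′ refl ; u≢u′ (inj₂ refl) → u≢u′ refl }) us!))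
    ws!
    (All.map⁺ (All.tabulate λ _ → All.tabulate λ e∈ →
      let w∈ , x∈ , _ = edgesOf-∈ ws e∈
      in λ { (inj₁ refl) → All.lookup v∉ w∈ refl ; (inj₂ refl) → All.lookup v∉ x∈ refl }))

  edgesOf-unique : ∀ {vs} → Unique vs → Unique≈ (edgesOf vs)
  edgesOf-unique []         = []
  edgesOf-unique (v∉ ∷ ws!) = star-++-unique v∉ (Unique.filter⁺ _ ws!) (edgesOf-unique ws!)

  -- Codegrees and the number of clashes.

  neighbours : Fin n → List (Fin n)
  neighbours u = filter (u ~?_) (allFin n)

  ∈-neighbours : ∀ {u w} → u ~ w → w ∈ neighbours u
  ∈-neighbours = ∈-filter⁺ _ (∈-allFin _)

  common : Fin n → Fin n → List (Fin n)
  common u x = filter (x ~?_) (neighbours u)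

  codegrees : Fin n → List (Fin n) → ℕ
  codegrees u B = sum (map (length ∘ common u) B)

  -- `block` is where the greedy colouring got stuck: the earlier neighbours of the
  -- vertex whose edge to `centre` has no free colour.
  record Crowded (d k : ℕ) : Set where
    constructor crowded
    field
      {centre} : Fin n
      {block}  : List (Fin n)
      block!   : Unique block
      block≤   : length block ≤ d
      k<       : k < codegrees centre block

  length-concatMap-star : ∀ (f : Fin n → List (Fin n)) xs →
                          length (concatMap (λ x → star x (f x)) xs) ≡ sum (map (length ∘ f) xs)
  length-concatMap-star f []       = refl
  length-concatMap-star f (x ∷ xs) = trans (length-++ (star x (f x)))
    (cong₂ _+_ (length-map (x ,_) (f x)) (length-concatMap-star f xs))

  module _ {v : Fin n} {ws : List (Fin n)} (v∉ : All (v ≢_) ws) (ws! : Unique ws) where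
    private
      B : List (Fin n)
      B = filter (v ~?_) ws

    -- An edge wx clashing with vu, where x is an earlier neighbour of v, has w adjacent
    -- to u; so it is counted once for x.  The count is strict since vu counts itself.
    clashes<codegrees : ∀ {u us} → All (_∈ B) (u ∷ us) → Unique (u ∷ us) →
      length (filter (clash? (v , u)) (star v us ++ edgesOf ws)) < codegrees u B
    clashes<codegrees {u} {us} (u∈B ∷ us⊆B) uus! = 
      subst (suc (length (filter (clash? (v , u)) (star v us ++ edgesOf ws))) ≤_)
      (length-concatMap-star (common u) B)
      (Unique-⊆⇒length≤ (DecSetoid.setoid ≈-decSetoid)
        (All.filter⁺ _ (AllPairs.head uniq) ∷ AllPairs.filter⁺ _ (AllPairs.tail uniq))
        (target u∈B (~-sym v~u) (~-sym v~u) ∷ All.tabulate λ f∈ →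
          let f∈es , clash = ∈-filter⁻ (clash? (v , u)) {xs = star v us ++ edgesOf ws} f∈
          in clashing (∈-++⁻ (star v us) f∈es) clash))
      where
      uniq : Unique≈ ((v , u) ∷ star v us ++ edgesOf ws)
      uniq = star-++-unique v∉ uus! (edgesOf-unique ws!)

      ∈B⇒~ : ∀ {x} → x ∈ B → v ~ x
      ∈B⇒~ x∈ = proj₂ (∈-filter⁻ (v ~?_) {xs = ws} x∈)

      v~u : v ~ u
      v~u = ∈B⇒~ u∈B

      -- An edge may occur in `T` in both orientations; only the length of `T`, which is the
      -- codegree sum, matters.
      T : List Edge
      T = concatMap (λ x → star x (common u x)) B

      target : ∀ {x w} → x ∈ B → x ~ w → u ~ w → (w , x) ∈≈ T
      target {x} {w} x∈ x~w u~w = Any.map (λ { refl → inj₂ refl })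
        (∈-concatMap⁺ (λ x → star x (common u x)) (lose x∈ (∈-map⁺ (x ,_) (∈-filter⁺ (x ~?_) (∈-neighbours u~w) x~w))))

      target′ : ∀ {x w} → x ∈ B → x ~ w → u ~ w → (x , w) ∈≈ T
      target′ x∈ x~w u~w = Any.map (λ { (inj₁ refl) → inj₂ refl ; (inj₂ refl) → inj₁ refl }) (target x∈ x~w u~w)

      clashing : ∀ {f} → f ∈ star v us ⊎ f ∈ edgesOf ws → Clash (v , u) f → f ∈≈ T
      clashing (inj₁ f∈) _ with ∈-map⁻ (v ,_) f∈
      -- Here w is `v` itself, a common neighbour of `u` and `x` because both lie in `B`.
      ... | x , x∈us , refl = let x∈B = All.lookup us⊆B x∈us in target x∈B (~-sym (∈B⇒~ x∈B)) (~-sym v~u)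
      clashing {w , x} (inj₂ f∈) clash with edgesOf-∈ ws f∈ | clash
      -- The end adjacent to `v` lies in `ws`, hence in `B`; the other end is adjacent to `u`. The
      -- two cases differ in which end is which.
      ... | w∈ , x∈ , w~x | inj₁ (v~w , u~x) = target′ (∈-filter⁺ (v ~?_) w∈ v~w) w~x u~x
      ... | w∈ , x∈ , w~x | inj₂ (v~x , u~w) = target  (∈-filter⁺ (v ~?_) x∈ v~x) (~-sym w~x) u~w

  -- Running the greedy colouring.

  module _ {d k : ℕ} where
    open Greedy ≈-decSetoid clash? k

    -- The tail `us` is coloured before `u`. If at least `k` coloured edges clash with `vu`, then
    -- `clashes<codegrees` puts `k` below the codegree sum over all earlier neighbours of `v`, not
    -- only those in `us`.
    colour-star : ∀ {v ws} → All (v ≢_) ws → Unique ws → length (filter (v ~?_) ws) ≤ d → Colouring (edgesOf ws) →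
      ∀ us → All (_∈ filter (v ~?_) ws) us → Unique us → Crowded d k ⊎ Colouring (star v us ++ edgesOf ws)
    colour-star v∉ ws! B≤d C [] _ _ = inj₂ C
    colour-star {v} {ws} v∉ ws! B≤d C (u ∷ us) (u∈ ∷ us⊆) (u∉ ∷ us!)
      with colour-star v∉ ws! B≤d C us us⊆ us!
    ... | inj₁ cr = inj₁ cr
    ... | inj₂ C′ with length (filter (clash? (v , u)) (star v us ++ edgesOf ws)) <? k
    ...   | yes few = inj₂ (extend (star-++-unique v∉ (u∉ ∷ us!) (edgesOf-unique ws!)) few C′)
    ...   | no ¬few = inj₁ (crowded (Unique.filter⁺ _ ws!) B≤d
                        (≤-<-trans (≮⇒≥ ¬few) (clashes<codegrees v∉ ws! (u∈ ∷ us⊆) (u∉ ∷ us!))))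

    colour-edgesOf : ∀ {vs} → Unique vs → EliminationOrder d vs → Crowded d k ⊎ Colouring (edgesOf vs)
    colour-edgesOf []         []            = inj₂ empty
    colour-edgesOf (v∉ ∷ ws!) (B≤d ∷ order) with colour-edgesOf ws! order
    ... | inj₁ cr = inj₁ cr
    ... | inj₂ C  = colour-star v∉ ws! B≤d C _ (All.tabulate id) (Unique.filter⁺ _ ws!)

  module _ {k : ℕ} where
    open Greedy ≈-decSetoid clash? k

    -- Incident edges and opposite edges of a 4-cycle both clash, so `proper` and `rainbow` reduce
    -- to `distinct`, once the edges are known to differ up to reversal.
    toBColoring : ∀ {vs} → (∀ v → v ∈ vs) → Colouring (edgesOf vs) → BColoring G k
    toBColoring {vs} vs-all C = record
      { color      = λ e → fromℕ< (bound e)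
      ; unoriented = λ e f → Fin.fromℕ<-cong _ _ (cong-≈ (inj₂ refl)) (bound e) (bound f)
      ; proper     = λ e f v≢w → distinct e f (inj₂ (f , ~-sym e))
                       λ { (inj₁ refl) → v≢w refl ; (inj₂ refl) → v≢w refl }
      ; rainbow    = λ ab bc cd da a≢c b≢d →
          (incident ab bc a≢c ∷ opposite ab bc cd da a≢c ∷ (incident da ab (b≢d ∘ sym) ∘ sym) ∷ [])
        ∷ (incident bc cd b≢d ∷ opposite bc cd da ab b≢d ∷ [])
        ∷ (incident cd da (a≢c ∘ sym) ∷ [])
        ∷ [] ∷ []
      }
      where
      open Colouring C

      listed : ∀ {a b} → a ~ b → ∃[ e ] e ∈ edgesOf vs × e ≈ (a , b)
      listed = edgesOf-complete vs (vs-all _) (vs-all _)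

      bound : ∀ {a b} → a ~ b → colour (a , b) < k
      bound a~b = let _ , e∈ , e≈ = listed a~b in subst (_< k) (cong-≈ e≈) (All.lookup bounded e∈)

      open DecSetoid ≈-decSetoid using () renaming (sym to ≈-sym; trans to ≈-trans)

      distinct : ∀ {a b c d} (ab : a ~ b) (cd : c ~ d) → Clash (a , b) (c , d) → ¬ (a , b) ≈ (c , d) →
                 fromℕ< (bound ab) ≢ fromℕ< (bound cd)
      distinct ab cd clash ab≉cd eq with listed ab | listed cd
      ... | e , e∈ , e≈ | f , f∈ , f≈
        -- The listed representatives `e` and `f` may occur in either order, hence the symmetric
        -- lookup. If they coincide, the original edges agree up to reversal; otherwise the clash is
        -- carried over to `e` and `f`.
        with AllPairs-lookup (λ sep cl → sep (Clash-sym cl) ∘ sym) separates e∈ f∈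
      ...   | inj₁ refl = ab≉cd (≈-trans (≈-sym e≈) f≈)
      ...   | inj₂ sep  = sep (Clash-respʳ-≈ f≈ (Clash-sym (Clash-respʳ-≈ e≈ (Clash-sym clash))))
        (trans (cong-≈ e≈) (trans (Fin.fromℕ<-injective _ _ (bound ab) (bound cd) eq) (sym (cong-≈ f≈))))

      incident : ∀ {a b c} (ab : a ~ b) (bc : b ~ c) → a ≢ c → fromℕ< (bound ab) ≢ fromℕ< (bound bc)
      incident ab bc a≢c = distinct ab bc (inj₁ (ab , bc))
        λ { (inj₁ refl) → a≢c refl ; (inj₂ refl) → a≢c refl }

      opposite : ∀ {a b c d} (ab : a ~ b) → b ~ c → (cd : c ~ d) → d ~ a → a ≢ c →
                 fromℕ< (bound ab) ≢ fromℕ< (bound cd)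
      opposite ab bc cd da a≢c = distinct ab cd (inj₂ (~-sym da , bc))
        λ { (inj₁ refl) → a≢c refl ; (inj₂ refl) → ~-irrefl refl da }

  crowded-or-coloured : ∀ {d k} → Degenerate d G → Crowded d k ⊎ BColoring G k
  crowded-or-coloured deg with eliminationOrder deg ∣ ⊤ {n} ∣ ⊤ ≤-refl
  ... | vs , vs! , order , all∈ , _ with colour-edgesOf vs! order
  ...   | inj₁ cr = inj₁ cr
  ...   | inj₂ C  = inj₂ (toBColoring (λ _ → all∈ ∈⊤) C)

  -- Extracting the two bipartite copies.

  degree≤maxDegree : ∀ v → degree G v ≤ maxDegree G
  degree≤maxDegree v = All.lookup (xs≤max 0 (map (degree G) (allFin n))) (∈-map⁺ (degree G) (∈-allFin v))

  commonAll : Fin n → List (Fin n) → List (Fin n)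
  commonAll u = foldr (λ x → filter (x ~?_)) (neighbours u)

  commonAll-⊆ : ∀ u B → commonAll u B ⊆ neighbours u
  commonAll-⊆ u []      = ⊆-refl
  commonAll-⊆ u (x ∷ B) = ⊆-trans (filter-⊆ (x ~?_) (commonAll u B)) (commonAll-⊆ u B)

  commonAll-unique : ∀ u B → Unique (commonAll u B)
  commonAll-unique u []      = Unique.filter⁺ (u ~?_) (Unique.allFin⁺ n)
  commonAll-unique u (x ∷ B) = Unique.filter⁺ (x ~?_) (commonAll-unique u B)

  commonAll⇒~ : ∀ u B {x w} → x ∈ B → w ∈ commonAll u B → x ~ w
  commonAll⇒~ u (x ∷ B) (here refl) w∈ = proj₂ (∈-filter⁻ (x ~?_) {xs = commonAll u B} w∈)
  commonAll⇒~ u (y ∷ B) (there x∈)  w∈ = commonAll⇒~ u B x∈ (proj₁ (∈-filter⁻ (y ~?_) w∈))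

  -- Union bound: a vertex of N(u) outside `commonAll u B` is missed by some x in `B`, and each x
  -- misses |N(u)| - |N(u) ∩ N(x)| vertices of N(u). All subtractions are moved across.
  codegrees≤ : ∀ u B → degree G u + codegrees u B ≤ length B * degree G u + length (commonAll u B)
  codegrees≤ u []      = ≤-reflexive (+-identityʳ (degree G u))
  codegrees≤ u (x ∷ B) = begin
    p + (m + codegrees u B)                            ≡⟨ solve 3 (λ p m t → p :+ (m :+ t) := (p :+ t) :+ m) refl p m (codegrees u B) ⟩
    (p + codegrees u B) + m                            ≤⟨ +-monoˡ-≤ m (codegrees≤ u B) ⟩
    (q + length (commonAll u B)) + m                   ≡⟨ solve 3 (λ q c m → (q :+ c) :+ m := q :+ (m :+ c)) refl q (length (commonAll u B)) m ⟩
    -- Filtering by x removes no more vertices from `commonAll u B` than from N(u).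
    q + (m + length (commonAll u B))                   ≤⟨ +-monoʳ-≤ q (length-filter-⊆ (x ~?_) (commonAll-⊆ u B)) ⟩
    q + (p + length (commonAll u (x ∷ B)))             ≡⟨ solve 3 (λ q p c → q :+ (p :+ c) := (p :+ q) :+ c) refl q p (length (commonAll u (x ∷ B))) ⟩
    (p + q) + length (commonAll u (x ∷ B))             ∎
    where
    open ≤-Reasoning
    p q m : ℕ
    p = degree G u
    q = length B * p
    m = length (common u x)

  -- The degeneracy bound of the theorem is `suc d` here.
  module _ {d Δ s : ℕ} (s<Δ : s < Δ) (Δ-bound : maxDegree G ≤ Δ)
           {u : Fin n} {B : List (Fin n)} (B! : Unique B) (B≤d : length B ≤ suc d)
           (many : suc d * Δ ∸ s ≤ codegrees u B) where
    open ≤-Reasoning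

    private
      p Σ : ℕ
      p = degree G u
      Σ = codegrees u B

      p≤Δ : p ≤ Δ
      p≤Δ = ≤-trans (degree≤maxDegree u) Δ-bound

      many′ : Δ + d * Δ ≤ s + Σ
      many′ = ≤-trans (m≤n+m∸n (Δ + d * Δ) s) (+-monoʳ-≤ s many)

      common≤Δ : ∀ x → length (common u x) ≤ Δ
      common≤Δ x = ≤-trans (length-filter (x ~?_) (neighbours u)) p≤Δ

      full? : U.Decidable (λ x → Δ ≤ length (common u x))
      full? x = Δ ≤? length (common u x)

      full : List (Fin n)
      full = filter full? B

      -- With at most d summands, each at most `Δ`, the codegree sum would force Δ ≤ s.
      length-B : length B ≡ suc d
      length-B = ≤-antisym B≤d (≮⇒≥ λ B<d → <⇒≱ s<Δ (+-cancelʳ-≤ (d * Δ) Δ s (begin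
        Δ + d * Δ      ≤⟨ many′ ⟩
        s + Σ          ≤⟨ +-monoʳ-≤ s (sum≤length* (length ∘ common u) common≤Δ B) ⟩
        s + length B * Δ ≤⟨ +-monoʳ-≤ s (*-monoˡ-≤ Δ (≤-pred B<d)) ⟩
        s + d * Δ      ∎)))

    copy-block-commonAll : ContainsCopy G K[ suc d , Δ ∸ s ]
    copy-block-commonAll = bipartite-copy B! (commonAll-unique u B) (≤-reflexive (sym length-B))
      (m≤n+o⇒m∸n≤o Δ s (+-cancelʳ-≤ (d * Δ) Δ (s + c) (begin
        Δ + d * Δ        ≤⟨ many′ ⟩
        s + Σ            ≤⟨ +-monoʳ-≤ s Σ≤ ⟩
        s + (d * Δ + c)  ≡⟨ solve 3 (λ s q c → s :+ (q :+ c) := (s :+ c) :+ q) refl s (d * Δ) c ⟩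
        (s + c) + d * Δ  ∎)))
      (commonAll⇒~ u B)
      where
      c : ℕ
      c = length (commonAll u B)

      Σ≤ : Σ ≤ d * Δ + c
      -- One copy of `p` is cancelled exactly; only the remaining d copies are enlarged to `Δ`.
      Σ≤ = +-cancelˡ-≤ p Σ (d * Δ + c) (begin
        p + Σ             ≤⟨ codegrees≤ u B ⟩
        length B * p + c  ≡⟨ cong (λ b → b * p + c) length-B ⟩
        (p + d * p) + c   ≡⟨ +-assoc p (d * p) c ⟩
        p + (d * p + c)   ≤⟨ +-monoʳ-≤ p (+-monoˡ-≤ c (*-monoʳ-≤ d p≤Δ)) ⟩
        p + (d * Δ + c)   ∎)

    copy-full-neighbours : s < suc d → ContainsCopy G K[ suc d ∸ s , Δ ]
    copy-full-neighbours s<d = bipartite-copy (Unique.filter⁺ _ B!) (Unique.filter⁺ _ (Unique.allFin⁺ n))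
      (m≤n+o⇒m∸n≤o (suc d) s d≤s+full) Δ≤p joined
      where
      -- The total deficit of the codegrees is at most `s`, so at most `s` members of `B` are not
      -- full.
      d≤s+full : suc d ≤ s + length full
      d≤s+full = +-cancelˡ-≤ (suc d * Δ) (suc d) (s + length full) (begin
        suc d * Δ + suc d               ≤⟨ +-monoˡ-≤ (suc d) many′ ⟩
        (s + Σ) + suc d                 ≡⟨ cong ((s + Σ) +_) length-B ⟨
        (s + Σ) + length B              ≡⟨ +-assoc s Σ (length B) ⟩
        s + (Σ + length B)              ≤⟨ +-monoʳ-≤ s (sum+length≤ (length ∘ common u) common≤Δ full? B) ⟩
        s + (length B * Δ + length full) ≡⟨ cong (λ b → s + (b * Δ + length full)) length-B ⟩
        s + (suc d * Δ + length full)   ≡⟨ solve 3 (λ s q f → s :+ (q :+ f) := q :+ (s :+ f)) refl s (suc d * Δ) (length full) ⟩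
        suc d * Δ + (s + length full)   ∎)

      full-nonempty : 0 < length full
      full-nonempty = +-cancelˡ-< s 0 (length full) (subst (_< s + length full) (sym (+-identityʳ s)) (≤-trans s<d d≤s+full))

      -- By `s<d` some x is full, and its at least `Δ` common neighbours with `u` all lie in N(u).
      Δ≤p : Δ ≤ p
      Δ≤p = let x∈ = ∈-lookup (fromℕ< full-nonempty)
                in ≤-trans (proj₂ (∈-filter⁻ full? {xs = B} x∈)) (length-filter (_ ~?_) (neighbours u))

      -- A vertex of N(u) missed by a full x would leave fewer than |N(u)| ≤ Δ common neighbours.
      joined : ∀ {x w} → x ∈ full → w ∈ neighbours u → x ~ w
      joined {x} {w} x∈ w∈ = decidable-stable (x ~? w) λ x≁w → <⇒≱
        (filter-notAll (x ~?_) (neighbours u) (lose w∈ x≁w))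
        (≤-trans p≤Δ (proj₂ (∈-filter⁻ full? {xs = B} x∈)))

theorem1p2 : (d Δ s : ℕ) → 1 ≤ d → d ≤ Δ → s < Δ →
    ∀ {n : ℕ} (G : Graph (Fin n)) → Degenerate d G → maxDegree G ≤ Δ →
    d * Δ ∸ s ≤ q_B G →
    ContainsCopy G K[ d , Δ ∸ s ] ×
    (s < d → ContainsCopy G K[ d ∸ s , Δ ])
theorem1p2 (suc d) Δ s _ _ s<Δ G deg Δ-bound q≥ with suc d * Δ ∸ s in eq
-- The difference is positive because s < Δ ≤ dΔ.
... | zero  = contradiction (m∸n≡0⇒m≤n eq) (<⇒≱ (≤-trans s<Δ (m≤m+n Δ (d * Δ))))
-- The greedy colouring gets k = dΔ - s - 1 colours, one too few for a B-coloring to exist.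
... | suc k with crowded-or-coloured G {k = k} deg
...   | inj₂ C = contradiction q≥ (≤⇒≯ (q_B-minimal G C))
...   | inj₁ (crowded {u} {B} B! B≤d k<) = copy-block-commonAll G s<Δ Δ-bound B! B≤d many
                                         , copy-full-neighbours G s<Δ Δ-bound B! B≤d many
  where
  many : suc d * Δ ∸ s ≤ codegrees G u B
  many = subst (_≤ codegrees G u B) (sym eq) k<
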